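{- Let $M$ be the simple digraph with six-element vertex set $\{a,b,a_0,b_0,a_1,b_1\}$ and arrow relation $$E=\{\langle a,a\rangle,\langle a,b\rangle,\langle b,a\rangle,\langle b,b\rangle,\langle a_0,b_0\rangle,\langle b_0,a_1\rangle,\langle a_1,b_1\rangle,\langle b_1,a_0\rangle,\langle a,a_0\rangle,\langle a,a_1\rangle,\langle b,b_0\rangle,\langle b,b_1\rangle\}.$$ Then $M$ is homogeneous but not uniformly homogeneous.
   Context: A simple digraph is a structure $\langle X,E\rangle$ where $E$ is a binary relation on $X$ (loops are allowed). Substructures are subsets with the induced relation; isomorphisms are bijections preserving the relation in both directions. A structure $M$ is homogeneous if every isomorphism between finitely generated substructures of $M$ extends to an automorphism of $M$. A structure $M$ is uniformly homogeneous if there is a functor $K$ from the category of all isomorphisms between finitely generated substructures of $M$ into the group $\operatorname{Aut}(M)$ (viewed as a category with a single object) such that $K(f)$ is an extension of $f$ for each $f$. Equivalently, $K$ assigns to each isomorphism $f$ between finitely generated substructures of $M$ a map $K(f)$ so that: (1) $K(\mathrm{id}_A)=\mathrm{id}_M$; (2) $K(f)\in\operatorname{Aut}(M)$ and $K(f)$ extends $f$; (3) $K(f\circ g)=K(f)\circ K(g)$, for all isomorphisms $f\colon A\to B$, $g\colon C\to A$ with $A,B,C$ finitely generated substructures of $M$. -}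

module Defs where

open import Level using (0ℓ)
open import Data.List.Base using (List)
import Data.List.Membership.Setoid as Membership
open import Data.Product.Base using (Σ; ∃; _,_; proj₁; proj₂)
open import Function.Base using (_on_)
open import Function.Bundles using (Inverse; _⇔_)
import Function.Construct.Composition as Composition
import Function.Construct.Identity as Identity
open import Relation.Binary.Bundles using (Setoid)
open import Relation.Binary.Core using (Rel)
open import Relation.Binary.Definitions using (_Respects₂_)
import Relation.Binary.Construct.On as On
open import Relation.Binary.PropositionalEquality using (resp₂)
import Relation.Binary.PropositionalEquality.Properties as ≡

-- Vertices form a setoid so that a substructure is again a digraph: its
-- vertices are pairs (x , x∈gs), which are equal as soon as the x's are.

record Digraph : Set₁ where
  infix 4 _⟶_
  field
    vertices : Setoid 0ℓ 0ℓ
  open Setoid vertices public using (_≈_) renaming (Carrier to V)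
  field
    _⟶_    : Rel V 0ℓ
    ⟶-resp : _⟶_ Respects₂ _≈_

open Digraph using (V; vertices)

infix 4 _≅_

record _≅_ (G H : Digraph) : Set where
  private
    module G = Digraph G
    module H = Digraph H
  field
    bijection : Inverse (vertices G) (vertices H)
  open Inverse bijection public using (to; from)
  field
    arrows : ∀ x y → (x G.⟶ y) ⇔ (to x H.⟶ to y)

open _≅_ using (bijection; arrows; to)

id-≅ : ∀ {G} → G ≅ G
id-≅ {G} = record
  { bijection = Identity.inverse (vertices G)
  ; arrows    = λ x y → Identity.⇔-id _
  }

infixr 9 _∘-≅_

_∘-≅_ : ∀ {G H K} → H ≅ K → G ≅ H → G ≅ K
f ∘-≅ g = record
  { bijection = Composition.inverse (bijection g) (bijection f)
  ; arrows    = λ x y →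
      Composition.equivalence (arrows g x y) (arrows f (to g x) (to g y))
  }

Aut : Digraph → Set
Aut M = M ≅ M

module _ (M : Digraph) where

  open Digraph M using (_≈_; _⟶_; ⟶-resp)
  open Membership (vertices M) using (_∈_)

  infix 4 _≈-Aut_ _Extends_ _≐_

  _≈-Aut_ : Rel (Aut M) 0ℓ
  φ ≈-Aut ψ = ∀ x → to φ x ≈ to ψ x

  -- The substructure generated by a finite list. There are no operations, so
  -- the generated set is just the set of entries; every finitely generated
  -- substructure (including the empty one) is of this form.

  ⟨_⟩ : List (V M) → Digraph
  ⟨ gs ⟩ = record
    { vertices = On.setoid {B = ∃ (_∈ gs)} (vertices M) proj₁
    ; _⟶_     = _⟶_ on proj₁
    ; ⟶-resp  = (λ {x} → proj₁ ⟶-resp) , (λ {x} → proj₂ ⟶-resp)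
    }

  _Extends_ : ∀ {as bs} → Aut M → ⟨ as ⟩ ≅ ⟨ bs ⟩ → Set
  φ Extends f = ∀ x → to φ (proj₁ x) ≈ proj₁ (to f x)

  Homogeneous : Set
  Homogeneous = ∀ {as bs} (f : ⟨ as ⟩ ≅ ⟨ bs ⟩) → ∃ λ φ → φ Extends f

  Graph : ∀ {as bs} → ⟨ as ⟩ ≅ ⟨ bs ⟩ → Rel (V M) 0ℓ
  Graph {as} f x y = Σ (x ∈ as) λ x∈as → proj₁ (to f (x , x∈as)) ≈ y

  -- Equality of isomorphisms as maps between subsets of M. Distinct lists may
  -- generate the same substructure, so f and g may have different list
  -- indices; equal graphs force equal domains and, by surjectivity, equal
  -- codomains.

  _≐_ : ∀ {as bs cs ds} → ⟨ as ⟩ ≅ ⟨ bs ⟩ → ⟨ cs ⟩ ≅ ⟨ ds ⟩ → Set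
  f ≐ g = ∀ x y → Graph f x y ⇔ Graph g x y

  -- K-cong says that K depends only on the isomorphism itself, not on the
  -- lists presenting its domain and codomain.

  record UniformlyHomogeneous : Set where
    field
      K         : ∀ {as bs} → ⟨ as ⟩ ≅ ⟨ bs ⟩ → Aut M
      K-cong    : ∀ {as bs cs ds} (f : ⟨ as ⟩ ≅ ⟨ bs ⟩) (g : ⟨ cs ⟩ ≅ ⟨ ds ⟩) →
                  f ≐ g → K f ≈-Aut K g
      K-id      : ∀ {as} → K (id-≅ {⟨ as ⟩}) ≈-Aut id-≅
      K-extends : ∀ {as bs} (f : ⟨ as ⟩ ≅ ⟨ bs ⟩) → K f Extends f
      K-∘       : ∀ {as bs cs} (f : ⟨ as ⟩ ≅ ⟨ bs ⟩) (g : ⟨ cs ⟩ ≅ ⟨ as ⟩) →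
                  K (f ∘-≅ g) ≈-Aut (K f ∘-≅ K g)

data Vertex : Set where
  a b a₀ b₀ a₁ b₁ : Vertex

data E : Rel Vertex 0ℓ where
  a→a   : E a  a
  a→b   : E a  b
  b→a   : E b  a
  b→b   : E b  b
  a₀→b₀ : E a₀ b₀
  b₀→a₁ : E b₀ a₁
  a₁→b₁ : E a₁ b₁
  b₁→a₀ : E b₁ a₀
  a→a₀  : E a  a₀
  a→a₁  : E a  a₁
  b→b₀  : E b  b₀
  b→b₁  : E b  b₁

M : Digraph
M = record
  { vertices = ≡.setoid Vertex
  ; _⟶_     = E
  ; ⟶-resp  = resp₂ E
  }

{-# OPTIONS --safe #-}

-- The automorphism group of M is cyclic of order 4, generated by the rotation
-- a ↔ b, a₀ → b₀ → a₁ → b₁ → a₀. Relative to an unlooped vertex the arrows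
-- identify every vertex, and relative to a looped one they identify the looped
-- vertices, so an isomorphism f between substructures agrees with any rotation
-- that agrees with f at one well-chosen vertex. On the other hand, the
-- involution of {a, b} swapping a and b extends only to the two rotations of
-- order 4, so no functorial extension exists.

module Submission where

open import Defs
open import Data.Fin.Base using (Fin; toℕ)
open import Data.Fin.Patterns using (0F; 1F; 2F; 3F; 4F; 5F)
import Data.Fin.Properties as Fin
open import Data.List.Base using (List; []; _∷_)
open import Data.List.Membership.Propositional using (_∈_; find)
import Data.List.Relation.Unary.All as All
open import Data.List.Relation.Unary.All.Properties using (¬All⇒Any¬)
open import Data.List.Relation.Unary.Any using (here; there)
open import Data.Nat.Base using (ℕ; zero; suc)
open import Data.Product.Base using (_×_; _,_; proj₁; proj₂; ∃)
open import Data.Sum.Base as Sum using (_⊎_; inj₁; inj₂)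
open import Function.Base using (_∘_)
open import Function.Bundles
  using (_⇔_; _↔_; mk⇔; mk↔ₛ′; module Equivalence; module Injection; module Inverse)
open import Function.Construct.Composition using (_⇔-∘_)
open import Function.Construct.Symmetry using (⇔-sym)
open import Function.Properties.Inverse using (↔⇒↣; Inverse⇒Injection)
open import Relation.Binary.Definitions using (Decidable; DecidableEquality)
open import Relation.Binary.PropositionalEquality
  using (_≡_; refl; sym; trans; cong; subst)
open import Relation.Nullary.Decidable
  using (Dec; yes; no; map′; via-injection; from-yes; ¬?; _×-dec_; _⊎-dec_; _→-dec_)
open import Relation.Nullary.Negation.Core using (¬_)
import Relation.Unary as Unary

open _≅_ using (bijection; arrows; to)

-- Through this enumeration `∀?` searches all vertices, so that `from-yes` proves finite facts about
-- `M` by evaluation.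
Vertex↔Fin6 : Vertex ↔ Fin 6
Vertex↔Fin6 = mk↔ₛ′ index vertex
  (λ { 0F → refl ; 1F → refl ; 2F → refl ; 3F → refl ; 4F → refl ; 5F → refl })
  (λ { a → refl ; b → refl ; a₀ → refl ; b₀ → refl ; a₁ → refl ; b₁ → refl })
  where
  index : Vertex → Fin 6
  index a  = 0F
  index b  = 1F
  index a₀ = 2F
  index b₀ = 3F
  index a₁ = 4F
  index b₁ = 5F

  vertex : Fin 6 → Vertex
  vertex 0F = a
  vertex 1F = b
  vertex 2F = a₀
  vertex 3F = b₀
  vertex 4F = a₁
  vertex 5F = b₁

infix 4 _≟_

_≟_ : DecidableEquality Vertex
_≟_ = via-injection (↔⇒↣ Vertex↔Fin6) Fin._≟_

∀? : ∀ {p} {P : Unary.Pred Vertex p} → Unary.Decidable P → Dec (∀ v → P v)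
∀? {P = P} P? = map′
  (λ ps v → subst P (Inverse.strictlyInverseʳ Vertex↔Fin6 v) (ps (Inverse.to Vertex↔Fin6 v)))
  (λ ps i → ps (Inverse.from Vertex↔Fin6 i))
  (Fin.all? (P? ∘ Inverse.from Vertex↔Fin6))

E? : Decidable E
E? a  a  = yes a→a
E? a  b  = yes a→b
E? a  a₀ = yes a→a₀
E? a  b₀ = no λ ()
E? a  a₁ = yes a→a₁
E? a  b₁ = no λ ()
E? b  a  = yes b→a
E? b  b  = yes b→b
E? b  a₀ = no λ ()
E? b  b₀ = yes b→b₀
E? b  a₁ = no λ ()
E? b  b₁ = yes b→b₁
E? a₀ a  = no λ ()
E? a₀ b  = no λ ()
E? a₀ a₀ = no λ ()
E? a₀ b₀ = yes a₀→b₀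
E? a₀ a₁ = no λ ()
E? a₀ b₁ = no λ ()
E? b₀ a  = no λ ()
E? b₀ b  = no λ ()
E? b₀ a₀ = no λ ()
E? b₀ b₀ = no λ ()
E? b₀ a₁ = yes b₀→a₁
E? b₀ b₁ = no λ ()
E? a₁ a  = no λ ()
E? a₁ b  = no λ ()
E? a₁ a₀ = no λ ()
E? a₁ b₀ = no λ ()
E? a₁ a₁ = no λ ()
E? a₁ b₁ = yes a₁→b₁
E? b₁ a  = no λ ()
E? b₁ b  = no λ ()
E? b₁ a₀ = yes b₁→a₀
E? b₁ b₀ = no λ ()
E? b₁ a₁ = no λ ()
E? b₁ b₁ = no λ ()

infix 2 _⇔-dec_

_⇔-dec_ : ∀ {p q} {P : Set p} {Q : Set q} → Dec P → Dec Q → Dec (P ⇔ Q)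
P? ⇔-dec Q? = map′ (λ (f , g) → mk⇔ f g) (λ e → Equivalence.to e , Equivalence.from e)
  ((P? →-dec Q?) ×-dec (Q? →-dec P?))

rotate : Vertex → Vertex
rotate a  = b
rotate b  = a
rotate a₀ = b₀
rotate b₀ = a₁
rotate a₁ = b₁
rotate b₁ = a₀

rotate³ : Vertex → Vertex
rotate³ = rotate ∘ rotate ∘ rotate

rotate⁴≗id : ∀ v → rotate (rotate³ v) ≡ v
rotate⁴≗id = from-yes (∀? λ v → rotate (rotate³ v) ≟ v)

rotation : Aut M
rotation = record
  { bijection = mk↔ₛ′ rotate rotate³ rotate⁴≗id rotate⁴≗id
  ; arrows    = from-yes (∀? λ x → ∀? λ y → E? x y ⇔-dec E? (rotate x) (rotate y))
  }

rotation^ : ℕ → Aut M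
rotation^ zero    = id-≅
rotation^ (suc k) = rotation ∘-≅ rotation^ k

-- The rotations have two orbits: the looped pair `a`, `b` and the unlooped 4-cycle. Four exponents
-- suffice, since `rotation` has order 4.
rotations-transitive : ∀ v w → E v v ⇔ E w w →
                       ∃ λ (k : Fin 4) → to (rotation^ (toℕ k)) v ≡ w
rotations-transitive = from-yes
  (∀? λ v → ∀? λ w → (E? v v ⇔-dec E? w w) →-dec
    Fin.any? {n = 4} λ k → to (rotation^ (toℕ k)) v ≟ w)

-- For unlooped `v`, one cycle neighbour precedes it, the other follows it, the opposite vertex is
-- not joined to it, and just one of `a`, `b` points to it. The equality clause separates `v` from
-- its opposite, and `a` from `b` when `v` is looped. A looped `v` cannot tell unlooped vertices
-- apart: `a` points to both `a₀` and `a₁`.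
arrows-determine : ∀ v x y → ¬ E v v ⊎ E x x →
                   E v x ⇔ E v y → E x v ⇔ E y v → E x x ⇔ E y y →
                   v ≡ x ⇔ v ≡ y → x ≡ y
arrows-determine = from-yes
  (∀? λ v → ∀? λ x → ∀? λ y →
    (¬? (E? v v) ⊎-dec E? x x) →-dec
    (E? v x ⇔-dec E? v y) →-dec (E? x v ⇔-dec E? y v) →-dec (E? x x ⇔-dec E? y y) →-dec
    (v ≟ x ⇔-dec v ≟ y) →-dec (x ≟ y))

≅-≡ : ∀ {G H} (f : G ≅ H) x y →
      Digraph._≈_ G x y ⇔ Digraph._≈_ H (to f x) (to f y)
≅-≡ f x y = mk⇔ (Inverse.to-cong (bijection f))
                (Injection.injective (Inverse⇒Injection (bijection f)))

module _ {as bs} (f : ⟨_⟩ M as ≅ ⟨_⟩ M bs) (φ : Aut M) where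

  -- Both maps preserve and reflect arrows and equality, so the two images of `x` are related in the
  -- same way to the common image of `v`, and `arrows-determine` applies there.
  agree-at-base : ∀ v x → ¬ E (proj₁ v) (proj₁ v) ⊎ E (proj₁ x) (proj₁ x) →
                  to φ (proj₁ v) ≡ proj₁ (to f v) → to φ (proj₁ x) ≡ proj₁ (to f x)
  agree-at-base v x base φv≡fv = arrows-determine (to φ v′) (to φ x′) (proj₁ (to f x))
    (Sum.map (_∘ Equivalence.from (arrows φ v′ v′))
             (Equivalence.to (arrows φ x′ x′)) base)
    (subst (λ w → E (to φ v′) (to φ x′) ⇔ E w (proj₁ (to f x))) (sym φv≡fv)
      (arrows f v x ⇔-∘ ⇔-sym (arrows φ v′ x′)))
    (subst (λ w → E (to φ x′) (to φ v′) ⇔ E (proj₁ (to f x)) w) (sym φv≡fv)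
      (arrows f x v ⇔-∘ ⇔-sym (arrows φ x′ v′)))
    (arrows f x x ⇔-∘ ⇔-sym (arrows φ x′ x′))
    (subst (λ w → to φ v′ ≡ to φ x′ ⇔ w ≡ proj₁ (to f x)) (sym φv≡fv)
      (≅-≡ f v x ⇔-∘ ⇔-sym (≅-≡ φ v′ x′)))
    where
    v′ = proj₁ v
    x′ = proj₁ x

-- Any unlooped entry serves for all `y` at once; if there is none, every `y` is looped and the head
-- will do.
base-vertex : ∀ x xs → ∃ λ v → v ∈ x ∷ xs × (∀ {y} → y ∈ x ∷ xs → ¬ E v v ⊎ E y y)
base-vertex x xs with All.all? (λ v → E? v v) (x ∷ xs)
... | yes looped  = x , here refl , λ y∈ → inj₂ (All.lookup looped y∈)
... | no  ¬looped =
  let v , v∈ , ¬vv = find (¬All⇒Any¬ (λ v → E? v v) (x ∷ xs) ¬looped)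
  in v , v∈ , λ _ → inj₁ ¬vv

M-homogeneous : Homogeneous M
-- Every automorphism extends the empty map.
M-homogeneous {[]}     f = id-≅ , λ { (_ , ()) }
M-homogeneous {x ∷ xs} f =
  let v , v∈ , base = base-vertex x xs
      -- `f` preserves and reflects the loop at `v`, so `v` and its image share an orbit.
      k , agree     = rotations-transitive v _ (arrows f (v , v∈) (v , v∈))
      φ             = rotation^ (toℕ k)
  in φ , λ y → agree-at-base f φ (v , v∈) y (base (proj₂ y)) agree

loops : List Vertex
loops = a ∷ b ∷ []

-- This makes any permutation of `a` and `b` an isomorphism.
loops-complete : ∀ {x y} → x ∈ loops → y ∈ loops → E x y
loops-complete (here refl)         (here refl)         = a→a
loops-complete (here refl)         (there (here refl)) = a→b
loops-complete (there (here refl)) (here refl)         = b→a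
loops-complete (there (here refl)) (there (here refl)) = b→b

swap-loops : ⟨_⟩ M loops ≅ ⟨_⟩ M loops
swap-loops = record
  { bijection = record
    { to        = swap
    ; from      = swap
    ; to-cong   = λ {x} {y} → swap-cong x y
    ; from-cong = λ {x} {y} → swap-cong x y
    ; inverse   = (λ {x} {y} → swap-inverse x y) , (λ {x} {y} → swap-inverse x y)
    }
  ; arrows = λ x y → mk⇔
      (λ _ → loops-complete (proj₂ (swap x)) (proj₂ (swap y)))
      (λ _ → loops-complete (proj₂ x) (proj₂ y))
  }
  where
  swap : ∃ (_∈ loops) → ∃ (_∈ loops)
  swap (_ , here refl)         = b , there (here refl)
  swap (_ , there (here refl)) = a , here refl

  -- `swap` matches on the membership proof, while equality sees only the vertex; `rotate` gives a
  -- value independent of that proof.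
  swap≗rotate : ∀ x → proj₁ (swap x) ≡ rotate (proj₁ x)
  swap≗rotate (_ , here refl)         = refl
  swap≗rotate (_ , there (here refl)) = refl

  swap-cong : ∀ x y → proj₁ x ≡ proj₁ y → proj₁ (swap x) ≡ proj₁ (swap y)
  swap-cong x y x≡y = trans (swap≗rotate x) (trans (cong rotate x≡y) (sym (swap≗rotate y)))

  swap-involutive : ∀ x → proj₁ (swap (swap x)) ≡ proj₁ x
  swap-involutive (_ , here refl)         = refl
  swap-involutive (_ , there (here refl)) = refl

  swap-inverse : ∀ x y → proj₁ y ≡ proj₁ (swap x) → proj₁ (swap y) ≡ proj₁ x
  swap-inverse x y y≡swap-x = trans (swap-cong y (swap x) y≡swap-x) (swap-involutive x)

swap-loops-involutive : _≐_ M (swap-loops ∘-≅ swap-loops) (id-≅ {⟨_⟩ M loops})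
swap-loops-involutive x y = mk⇔
  (λ { (here refl , refl) → here refl , refl
     ; (there (here refl) , refl) → there (here refl) , refl })
  (λ { (here refl , refl) → here refl , refl
     ; (there (here refl) , refl) → there (here refl) , refl })

-- The image of a₀ would be an unlooped out-neighbour of b joined to a₀ either
-- in both directions or in neither, but b₀ and b₁ are joined to a₀ in just one.
no-involution-swaps-loops : (σ : Aut M) → to σ a ≡ b → ¬ (∀ v → to σ (to σ v) ≡ v)
no-involution-swaps-loops σ σa≡b σσ≗id = no-image
  (subst (λ v → E v (to σ a₀)) σa≡b (Equivalence.to (arrows σ a a₀) a→a₀))
  (unlooped ∘ Equivalence.from (arrows σ a₀ a₀))
  (subst (λ v → E a₀ (to σ a₀) ⇔ E (to σ a₀) v) (σσ≗id a₀) (arrows σ a₀ (to σ a₀)))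
  where
  unlooped : ¬ E a₀ a₀
  unlooped ()

  no-image : ∀ {w} → E b w → ¬ E w w → ¬ (E a₀ w ⇔ E w a₀)
  no-image b→a  unlooped _ = unlooped a→a
  no-image b→b  unlooped _ = unlooped b→b
  no-image b→b₀ _ e with () ← Equivalence.to e a₀→b₀
  no-image b→b₁ _ e with () ← Equivalence.from e b₁→a₀

M-not-uniformly-homogeneous : ¬ UniformlyHomogeneous M
M-not-uniformly-homogeneous U = no-involution-swaps-loops (K swap-loops)
  (K-extends swap-loops (a , here refl))
  -- Functoriality makes the extension an involution: `K s ∘ K s = K (s ∘ s) = K id = id` for `s`
  -- the swap.
  λ v → trans (sym (K-∘ swap-loops swap-loops v))
       (trans (K-cong (swap-loops ∘-≅ swap-loops) id-≅ swap-loops-involutive v) (K-id v))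
  where open UniformlyHomogeneous U

theorem2p1 : Homogeneous M × ¬ UniformlyHomogeneous M
theorem2p1 = M-homogeneous , M-not-uniformly-homogeneous
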